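{- Let $S$ be a positive integer and let $N_S \geq 0$ be an integer. Suppose that $m_A \geq S/3$ for every set $A \subset \mathbb{Z}_{>0}$ of size $n$ and every integer $n$ with $N_S < n \leq 3N_S + 2S$. Then $m_A \geq S/3$ for every finite set $A \subset \mathbb{Z}_{>0}$ of size $n$ and every integer $n > N_S$.
   Context: Let $f:\mathbb{R}\to\mathbb{R}$ be the $1$-periodic function with $f(x) = 1_{[1/3,2/3)}(x) - 1/3$ for $x \in [0,1)$. For a finite set $A \subset \mathbb{Z}_{>0}$ put $f_A(x) = \sum_{a \in A} f(ax)$ and $m_A = \max_{x \in \mathbb{R}} f_A(x)$. -}

module Defs where

open import Data.Bool using (Bool; T; T?; if_then_else_)
open import Data.Empty using (⊥-elim)
open import Data.Integer using (ℤ; +_; -[1+_])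
import Data.Integer as ℤ
import Data.Integer.Properties as ℤ
open import Data.List using (List; length; map; foldr)
open import Data.List.Relation.Unary.All using (All)
open import Data.List.Relation.Unary.Unique.Propositional using (Unique)
open import Data.Nat using (ℕ; zero; suc)
import Data.Nat as ℕ
import Data.Nat.Properties as ℕ
open import Data.Product using (∃; ∃-syntax; _×_; _,_; proj₁; proj₂)
open import Data.Rational
  using (ℚ; mkℚ; ↥_; *≤*; 0ℚ; 1ℚ; _/_; 1/_; _+_; _-_; _*_; -_; _≤_; _<_)
import Data.Rational.Properties as ℚ
open import Data.Rational.Literals using (fromℤ)
open import Function using (_∘_)
open import Relation.Binary.Definitions using (tri<; tri≈; tri>)
open import Relation.Binary.PropositionalEquality
open import Relation.Nullary using (¬_; Dec; yes; no; does)
open import Relation.Nullary.Decidable using (⌊_⌋; toWitness; fromWitness; ¬?; _×-dec_)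

-- Real numbers as Dedekind cuts.  A real x is given by its upper cut
-- {q ∈ ℚ ∣ x < q}: nonempty, not all of ℚ, upward closed, without least element.
-- The cut is Bool-valued, so that x < q is decidable and the step function f below
-- is a total function.  Classically every Dedekind cut is of this form, so this is
-- the usual ℝ; each real, rational or not, has exactly one upper cut.
record ℝ : Set where
  field
    upper     : ℚ → Bool
    inhabited : ∃[ q ] T (upper q)
    bounded   : ∃[ q ] ¬ T (upper q)
    closed    : ∀ {p q} → p < q → T (upper p) → T (upper q)
    rounded   : ∀ {q} → T (upper q) → ∃[ p ] (p < q × T (upper p))

open ℝ

infix 4 _<ʳ_ _≤ʳ_ _<ʳ?_ _≤ʳ?_

_<ʳ_ : ℝ → ℚ → Set
x <ʳ q = T (upper x q)

_≤ʳ_ : ℚ → ℝ → Set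
q ≤ʳ x = ¬ (x <ʳ q)

_<ʳ?_ : ∀ x q → Dec (x <ʳ q)
x <ʳ? q = T? (upper x q)

_≤ʳ?_ : ∀ q x → Dec (q ≤ʳ x)
q ≤ʳ? x = ¬? (x <ʳ? q)

fromℚ : ℚ → ℝ
fromℚ r = record
  { upper     = λ q → ⌊ r ℚ.<? q ⌋
  ; inhabited = r + 1ℚ , fromWitness (subst (_< r + 1ℚ) (ℚ.+-identityʳ r)
                                        (ℚ.+-monoʳ-< r (ℚ.positive⁻¹ 1ℚ)))
  ; bounded   = r , ℚ.<-irrefl refl ∘ toWitness
  ; closed    = λ p<q r<p → fromWitness (ℚ.<-trans (toWitness r<p) p<q)
  ; rounded   = λ r<q → let p , r<p , p<q = ℚ.<-dense (toWitness r<q) in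
                  p , p<q , fromWitness r<p
  }

-- The image of x under the increasing bijection h of ℚ with inverse g, extended to ℝ:
-- h(x) < q if and only if x < g(q).
transport : (g h : ℚ → ℚ) →
            (∀ {p q} → p < q → g p < g q) → (∀ {p q} → p < q → h p < h q) →
            (∀ q → g (h q) ≡ q) → (∀ q → h (g q) ≡ q) → ℝ → ℝ
transport g h g-mono h-mono gh hg x = record
  { upper     = upper x ∘ g
  ; inhabited = let q , x<q = inhabited x in h q , subst (x <ʳ_) (sym (gh q)) x<q
  ; bounded   = let q , q≤x = bounded x in h q , q≤x ∘ subst (x <ʳ_) (gh q)
  ; closed    = closed x ∘ g-mono
  ; rounded   = λ {q} x<gq → let p , p<gq , x<p = rounded x x<gq in
                  h p , subst (h p <_) (hg q) (h-mono p<gq) , subst (x <ʳ_) (sym (gh p)) x<p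
  }

infixl 6 _-ʳ_
infixl 7 _·_

_-ʳ_ : ℝ → ℚ → ℝ
x -ʳ r = transport (_+ r) (_- r) (ℚ.+-monoˡ-< r) (ℚ.+-monoˡ-< (- r)) gh hg x
  where
  gh : ∀ q → q - r + r ≡ q
  gh q = trans (ℚ.+-assoc q (- r) r)
               (trans (cong (_+_ q) (ℚ.+-inverseˡ r)) (ℚ.+-identityʳ q))

  hg : ∀ q → q + r - r ≡ q
  hg q = trans (ℚ.+-assoc q r (- r))
               (trans (cong (_+_ q) (ℚ.+-inverseʳ r)) (ℚ.+-identityʳ q))

_·_ : ℕ → ℝ → ℝ
zero    · x = fromℚ 0ℚ
a@(suc _) · x = transport (_* 1/ r) (_* r) (ℚ.*-monoˡ-<-pos (1/ r)) (ℚ.*-monoˡ-<-pos r) gh hg x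
  where
  r = fromℤ (+ a)

  gh : ∀ q → q * r * 1/ r ≡ q
  gh q = trans (ℚ.*-assoc q r (1/ r))
               (trans (cong (q *_) (ℚ.*-inverseʳ r)) (ℚ.*-identityʳ q))

  hg : ∀ q → q * 1/ r * r ≡ q
  hg q = trans (ℚ.*-assoc q (1/ r) r)
               (trans (cong (q *_) (ℚ.*-inverseˡ r)) (ℚ.*-identityʳ q))

below : ∀ q → fromℤ (ℤ.- (+ ℤ.∣ ↥ q ∣)) ≤ q
below (mkℚ (+ 0)       d _) = *≤* (ℤ.+≤+ ℕ.z≤n)
below (mkℚ (+ (suc n)) d _) = *≤* ℤ.-≤+
below (mkℚ -[1+ n ]    d _) = *≤* (ℤ.-≤- (ℕ.s≤s⁻¹ (ℕ.*-monoʳ-≤ (suc n) (ℕ.s≤s (ℕ.z≤n {d})))))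

above : ∀ q → q ≤ fromℤ (+ ℤ.∣ ↥ q ∣)
above (mkℚ (+ 0)       d _) = *≤* (ℤ.+≤+ ℕ.z≤n)
above (mkℚ (+ (suc n)) d _) = *≤* (ℤ.+≤+ (ℕ.*-monoʳ-≤ (suc n) (ℕ.s≤s (ℕ.z≤n {d}))))
above (mkℚ -[1+ n ]    d _) = *≤* ℤ.-≤+

floor : (x : ℝ) → ∃[ k ] (fromℤ k ≤ʳ x × x <ʳ fromℤ (ℤ.suc k))
floor x = search (ℤ.- (+ m)) (m ℕ.+ n) lower (subst (λ k → x <ʳ fromℤ k) (sym eq) higher)
  where
  closed≤ : ∀ {p q} → p ≤ q → x <ʳ p → x <ʳ q
  closed≤ {p} {q} p≤q x<p with ℚ.<-cmp p q
  ... | tri< p<q _ _ = closed x p<q x<p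
  ... | tri≈ _ p≡q _ = subst (x <ʳ_) p≡q x<p
  ... | tri> _ _ p>q = ⊥-elim (ℚ.<-irrefl refl (ℚ.<-≤-trans p>q p≤q))

  m = ℤ.∣ ↥ (proj₁ (bounded x)) ∣
  n = ℤ.∣ ↥ (proj₁ (inhabited x)) ∣

  lower : fromℤ (ℤ.- (+ m)) ≤ʳ x
  lower = proj₂ (bounded x) ∘ closed≤ (below (proj₁ (bounded x)))

  higher : x <ʳ fromℤ (+ n)
  higher = closed≤ (above (proj₁ (inhabited x))) (proj₂ (inhabited x))

  eq : ℤ.- (+ m) ℤ.+ + (m ℕ.+ n) ≡ + n
  eq = begin
    ℤ.- (+ m) ℤ.+ (+ m ℤ.+ + n)  ≡⟨ ℤ.+-assoc (ℤ.- (+ m)) (+ m) (+ n) ⟨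
    ℤ.- (+ m) ℤ.+ + m ℤ.+ + n    ≡⟨ cong (ℤ._+ + n) (ℤ.+-inverseˡ (+ m)) ⟩
    + 0 ℤ.+ + n                  ≡⟨ ℤ.+-identityˡ (+ n) ⟩
    + n                          ∎
    where open ≡-Reasoning

  search : ∀ k j → fromℤ k ≤ʳ x → x <ʳ fromℤ (k ℤ.+ + j) →
           ∃[ k ] (fromℤ k ≤ʳ x × x <ʳ fromℤ (ℤ.suc k))
  search k zero    k≤x x<k = ⊥-elim (k≤x (subst (λ i → x <ʳ fromℤ i) (ℤ.+-identityʳ k) x<k))
  search k (suc j) k≤x x<k+1+j with x <ʳ? fromℤ (ℤ.suc k)
  ... | yes x<1+k = k , k≤x , x<1+k
  ... | no  1+k≤x = search (ℤ.suc k) j 1+k≤x (subst (λ i → x <ʳ fromℤ i) shift x<k+1+j)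
    where
    shift : k ℤ.+ + suc j ≡ ℤ.suc k ℤ.+ + j
    shift = trans (sym (ℤ.+-assoc k (+ 1) (+ j))) (cong (ℤ._+ + j) (ℤ.+-comm k (+ 1)))

frac : ℝ → ℝ
frac x = x -ʳ fromℤ (proj₁ (floor x))

𝟙[⅓,⅔⦆ : ℝ → ℚ
𝟙[⅓,⅔⦆ y = if does ((+ 1 / 3 ≤ʳ? y) ×-dec (y <ʳ? + 2 / 3)) then 1ℚ else 0ℚ

-- f takes only the values 2/3 and −1/3, so its codomain is restricted to ℚ.
f : ℝ → ℚ
f x = 𝟙[⅓,⅔⦆ (frac x) - + 1 / 3

-- A finite set of positive integers, enumerated without repetition.
record FiniteSet⁺ : Set where
  field
    elements : List ℕ
    positive : All (0 ℕ.<_) elements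
    distinct : Unique elements

open FiniteSet⁺ public

∣_∣ : FiniteSet⁺ → ℕ
∣ A ∣ = length (elements A)

f[_] : FiniteSet⁺ → ℝ → ℚ
f[ A ] x = foldr _+_ 0ℚ (map (λ a → f (a · x)) (elements A))

IsMaximumOf : ℚ → (ℝ → ℚ) → Set
IsMaximumOf m g = (∃[ x ] g x ≡ m) × (∀ x → g x ≤ m)

-- "m_A ≥ c": the maximum of f_A exists and is at least c.
m[_]≥_ : FiniteSet⁺ → ℚ → Set
m[ A ]≥ c = ∃[ m ] (IsMaximumOf m f[ A ] × c ≤ m)

{-# OPTIONS --safe #-}
module Submission where

-- Let A′ = {d : 3d ∈ A}.  The average of f_A over x/3, (x + 1)/3 and (x + 2)/3 is f_{A′}(x),
-- because f has period 1 and, for a not divisible by 3, the identity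
-- f(y) + f(y + 1/3) + f(y + 2/3) = 0 cancels the contribution of a; hence m_A ≥ m_{A′}.  So if
-- ∣A′∣ > N, then A′, whose sum of elements is smaller, takes care of A.  Otherwise the multiples
-- of 3 contribute at least −2N/3 to f_A(1/3) + f_A(2/3), while every other element contributes
-- exactly 1/3; if ∣A∣ > 3N + 2S, one of the two values is at least S/3.
--
-- The maximum is attained because f_A(x) depends only on ⌊3Lx⌋ modulo 3L, where L is a common
-- multiple of the elements of A.

open import Defs
open import Data.Empty using (⊥-elim)
open import Data.Integer using (ℤ; +_; -[1+_])
import Data.Integer as ℤ
import Data.Integer.DivMod as ℤ
import Data.Integer.Properties as ℤ
import Data.Integer.Tactic.RingSolver as ℤ-Solver
open import Data.List using (List; []; _∷_; length; map; foldr)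
open import Data.List.Relation.Unary.All as All using (All; []; _∷_)
open import Data.List.Relation.Unary.AllPairs using ([]; _∷_)
open import Data.List.Relation.Unary.Unique.Propositional using (Unique)
open import Data.Nat
  using (ℕ; zero; suc; NonZero; _+_; _*_; _≤_; _<_; _/_; z≤n; s≤s; >-nonZero; >-nonZero⁻¹)
open import Data.Nat.Divisibility using (_∣_; divides; ∣-trans; m∣m*n; ∣n⇒∣m*n)
open import Data.Nat.Induction using (<-wellFounded)
import Data.Nat.DivMod as ℕ
import Data.Nat.Properties as ℕ
import Data.Nat.Tactic.RingSolver as ℕ-Solver
open import Data.Nat.ListAction using (sum; product)
open import Data.Nat.ListAction.Properties using (∈⇒∣product; product≢0)
open import Data.Product using (∃-syntax; _×_; _,_; proj₁)
open import Data.Rational using (ℚ; toℚᵘ; 1/_; 0ℚ)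
import Data.Rational as ℚ
import Data.Rational.Properties as ℚ
open import Data.Rational.Literals using (fromℤ)
open import Data.Rational.Unnormalised using (mkℚᵘ; *≡*; *≤*; *<*)
  renaming (_/_ to _/ᵘ_; _≃_ to _≃ᵘ_)
import Data.Rational.Unnormalised.Properties as ℚᵘ
open import Data.Sum using (_⊎_; inj₁; inj₂; [_,_]′)
open import Function using (_∘_)
open import Induction.WellFounded using (Acc; acc)
open import Relation.Binary.Definitions using (tri<; tri≈; tri>)
open import Relation.Binary.PropositionalEquality
open import Relation.Nullary using (¬_; yes; no)
open import Relation.Nullary.Decidable using (_×-dec_; fromWitness; toWitness; dec-true; dec-false)

open ℝ

private
  variable
    p q : ℚ
    i j : ℤ

-- Rational arithmetic through unreduced fractions.

infix 4 _≈_÷_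

-- Without reduction to lowest terms, sums and comparisons of rationals become integer statements
-- within reach of a ring solver. The record keeps `q`, `i` and `n` inferable.
record _≈_÷_ (q : ℚ) (i : ℤ) (n : ℕ) .{{_ : NonZero n}} : Set where
  constructor mk≈
  field unwrap : toℚᵘ q ≃ᵘ i /ᵘ n

/-≈ : ∀ i n .{{_ : NonZero n}} → i ℚ./ n ≈ i ÷ n
/-≈ i (suc n) = mk≈ (ℚ.toℚᵘ-fromℚᵘ (mkℚᵘ i n))

fromℤ-≈ : ∀ i → fromℤ i ≈ i ÷ 1
fromℤ-≈ i = mk≈ ℚᵘ.≃-refl

-- For positive `a`, `a · x <ʳ q` unfolds to `x <ʳ q * 1/a`; these are the quotients that occur
-- there.
*1/-≈ : ∀ {m} n → p ≈ i ÷ suc m → p ℚ.* 1/ fromℤ (+ suc n) ≈ i ℤ.* + 1 ÷ (suc m * suc n)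
*1/-≈ {p} n (mk≈ p≃) = mk≈ (ℚᵘ.≃-trans (ℚ.toℚᵘ-homo-* p (1/ fromℤ (+ suc n))) (ℚᵘ.*-congʳ p≃))

+-≈ : ∀ {m n} → p ≈ i ÷ suc m → q ≈ j ÷ suc n →
      p ℚ.+ q ≈ i ℤ.* + suc n ℤ.+ j ℤ.* + suc m ÷ (suc m * suc n)
+-≈ {p} {q = q} (mk≈ p≃) (mk≈ q≃) = mk≈ (ℚᵘ.≃-trans (ℚ.toℚᵘ-homo-+ p q) (ℚᵘ.+-cong p≃ q≃))

≈-≤ : ∀ {m n} → p ≈ i ÷ suc m → q ≈ j ÷ suc n → i ℤ.* + suc n ℤ.≤ j ℤ.* + suc m → p ℚ.≤ q
≈-≤ (mk≈ p≃) (mk≈ q≃) le = ℚ.toℚᵘ-cancel-≤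
  (ℚᵘ.≤-respˡ-≃ (ℚᵘ.≃-sym p≃) (ℚᵘ.≤-respʳ-≃ (ℚᵘ.≃-sym q≃) (*≤* le)))

≤-≈ : ∀ {m n} → p ≈ i ÷ suc m → q ≈ j ÷ suc n → p ℚ.≤ q → i ℤ.* + suc n ℤ.≤ j ℤ.* + suc m
≤-≈ (mk≈ p≃) (mk≈ q≃) le with ℚᵘ.≤-respˡ-≃ p≃ (ℚᵘ.≤-respʳ-≃ q≃ (ℚ.toℚᵘ-mono-≤ le))
... | *≤* le′ = le′

≈-< : ∀ {m n} → p ≈ i ÷ suc m → q ≈ j ÷ suc n → i ℤ.* + suc n ℤ.< j ℤ.* + suc m → p ℚ.< q
≈-< (mk≈ p≃) (mk≈ q≃) lt = ℚ.toℚᵘ-cancel-<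
  (ℚᵘ.<-respˡ-≃ (ℚᵘ.≃-sym p≃) (ℚᵘ.<-respʳ-≃ (ℚᵘ.≃-sym q≃) (*<* lt)))

<-≈ : ∀ {m n} → p ≈ i ÷ suc m → q ≈ j ÷ suc n → p ℚ.< q → i ℤ.* + suc n ℤ.< j ℤ.* + suc m
<-≈ (mk≈ p≃) (mk≈ q≃) lt with ℚᵘ.<-respˡ-≃ p≃ (ℚᵘ.<-respʳ-≃ q≃ (ℚ.toℚᵘ-mono-< lt))
... | *<* lt′ = lt′

≈-≡ : ∀ {m n} → p ≈ i ÷ suc m → q ≈ j ÷ suc n → i ℤ.* + suc n ≡ j ℤ.* + suc m → p ≡ q
≈-≡ (mk≈ p≃) (mk≈ q≃) eq = ℚ.toℚᵘ-injective (ℚᵘ.≃-trans p≃ (ℚᵘ.≃-trans (*≡* eq) (ℚᵘ.≃-sym q≃)))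

-- Comparison of cuts with rationals, and integer multiples of 1/3.

<ʳ-≤-trans : ∀ x → x <ʳ p → p ℚ.≤ q → x <ʳ q
<ʳ-≤-trans {p} {q} x x<p p≤q with ℚ.<-cmp p q
... | tri< p<q _ _ = closed x p<q x<p
... | tri≈ _ p≡q _ = subst (x <ʳ_) p≡q x<p
... | tri> _ _ p>q = ⊥-elim (ℚ.<-irrefl refl (ℚ.<-≤-trans p>q p≤q))

≤-≤ʳ-trans : ∀ x → p ℚ.≤ q → q ≤ʳ x → p ≤ʳ x
≤-≤ʳ-trans x p≤q q≤x x<p = q≤x (<ʳ-≤-trans x x<p p≤q)

≤ʳ-<ʳ-trans : ∀ x → p ≤ʳ x → x <ʳ q → p ℚ.< q
≤ʳ-<ʳ-trans x p≤x x<q = ℚ.≰⇒> λ q≤p → p≤x (<ʳ-≤-trans x x<q q≤p)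

infixl 7 _/3

_/3 : ℤ → ℚ
i /3 = i ℚ./ 3

/3-≈ : ∀ i → i /3 ≈ i ÷ 3
/3-≈ i = /-≈ i 3

/3-mono-≤ : i ℤ.≤ j → i /3 ℚ.≤ j /3
/3-mono-≤ {i} {j} i≤j = ≈-≤ (/3-≈ i) (/3-≈ j) (ℤ.*-monoʳ-≤-nonNeg (+ 3) i≤j)

/3-cancel-≤ : i /3 ℚ.≤ j /3 → i ℤ.≤ j
/3-cancel-≤ {i} {j} le = ℤ.*-cancelʳ-≤-pos i j (+ 3) (≤-≈ (/3-≈ i) (/3-≈ j) le)

/3-cancel-< : i /3 ℚ.< j /3 → i ℤ.< j
/3-cancel-< {i} {j} lt = ℤ.*-cancelʳ-<-nonNeg {i} {j} (+ 3) (<-≈ (/3-≈ i) (/3-≈ j) lt)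

/3-+ : ∀ i j → i /3 ℚ.+ j /3 ≡ (i ℤ.+ j) /3
/3-+ i j = ≈-≡ (+-≈ (/3-≈ i) (/3-≈ j)) (/3-≈ (i ℤ.+ j)) (eq i j)
  where
  eq : ∀ i j → (i ℤ.* + 3 ℤ.+ j ℤ.* + 3) ℤ.* + 3 ≡ (i ℤ.+ j) ℤ.* + 9
  eq = ℤ-Solver.solve-∀

-- Needed because the cut of `x -ʳ fromℤ n` at `i /3` unfolds to the cut of `x` at this sum.
/3-+-fromℤ : ∀ i n → i /3 ℚ.+ fromℤ n ≡ (i ℤ.+ n ℤ.* + 3) /3
/3-+-fromℤ i n = ≈-≡ (+-≈ (/3-≈ i) (fromℤ-≈ n)) (/3-≈ (i ℤ.+ n ℤ.* + 3)) (eq i n)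
  where
  eq : ∀ i n → (i ℤ.* + 1 ℤ.+ n ℤ.* + 3) ℤ.* + 3 ≡ (i ℤ.+ n ℤ.* + 3) ℤ.* + 3
  eq = ℤ-Solver.solve-∀

fromℤ-/3 : ∀ n → fromℤ n ≡ (n ℤ.* + 3) /3
fromℤ-/3 n = ≈-≡ (fromℤ-≈ n) (/3-≈ (n ℤ.* + 3)) (sym (ℤ.*-identityʳ (n ℤ.* + 3)))

-- The step function in terms of the integer part of 3y.

-- 3 f(y) as a function of ⌊3y⌋
φ : ℕ → ℤ
φ 0                   = -[1+ 0 ]
φ 1                   = + 2
φ 2                   = -[1+ 0 ]
φ (suc (suc (suc c))) = φ c

𝟙-inside : ∀ y → + 1 /3 ≤ʳ y → y <ʳ + 2 /3 → 𝟙[⅓,⅔⦆ y ≡ ℚ.1ℚ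
𝟙-inside y ⅓≤y y<⅔
  rewrite dec-true ((+ 1 /3 ≤ʳ? y) ×-dec (y <ʳ? + 2 /3)) (⅓≤y , y<⅔) = refl

𝟙-outside : ∀ y → ¬ (+ 1 /3 ≤ʳ y × y <ʳ + 2 /3) → 𝟙[⅓,⅔⦆ y ≡ 0ℚ
𝟙-outside y y∉
  rewrite dec-false ((+ 1 /3 ≤ʳ? y) ×-dec (y <ʳ? + 2 /3)) y∉ = refl

-- If `x` lies in both [m, m + 1) and [n, n + 1), then `n < 1 + m` and `m < 1 + n`. The bounds are
-- written in thirds, as `f-φ` supplies them.
floor-unique : ∀ x m → (m ℤ.* + 3) /3 ≤ʳ x → x <ʳ ((ℤ.suc m) ℤ.* + 3) /3 → proj₁ (floor x) ≡ m
floor-unique x m m≤x x<1+m with floor x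
... | n , n≤x , x<1+n = ℤ.≤-antisym
  (<suc⇒≤ (cancel n (ℤ.suc m) (≤ʳ-<ʳ-trans x (subst (_≤ʳ x) (fromℤ-/3 n) n≤x) x<1+m)))
  (<suc⇒≤ (cancel m (ℤ.suc n) (≤ʳ-<ʳ-trans x m≤x (subst (x <ʳ_) (fromℤ-/3 (ℤ.suc n)) x<1+n))))
  where
  cancel : ∀ i j → (i ℤ.* + 3) /3 ℚ.< (j ℤ.* + 3) /3 → i ℤ.< j
  cancel i j lt = ℤ.*-cancelʳ-<-nonNeg {i} {j} (+ 3) (/3-cancel-< {i ℤ.* + 3} {j ℤ.* + 3} lt)
  <suc⇒≤ : i ℤ.< ℤ.suc j → i ℤ.≤ j
  <suc⇒≤ {i} {j} lt = subst (i ℤ.≤_) (ℤ.pred-suc j) (ℤ.i<j⇒i≤pred[j] lt)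

+/3-mono : ∀ m {c d} → c ≤ d → (+ c ℤ.+ m ℤ.* + 3) /3 ℚ.≤ (+ d ℤ.+ m ℤ.* + 3) /3
+/3-mono m c≤d = /3-mono-≤ (ℤ.+-monoˡ-≤ (m ℤ.* + 3) (ℤ.+≤+ c≤d))

f-floor : ∀ x m → (+ 0 ℤ.+ m ℤ.* + 3) /3 ≤ʳ x → x <ʳ (+ 3 ℤ.+ m ℤ.* + 3) /3 →
          f x ≡ 𝟙[⅓,⅔⦆ (x -ʳ fromℤ m) ℚ.- + 1 /3
f-floor x m lo hi = cong (λ n → 𝟙[⅓,⅔⦆ (x -ʳ fromℤ n) ℚ.- + 1 /3) (floor-unique x m
  (subst (λ i → i /3 ≤ʳ x) (ℤ.+-identityˡ (m ℤ.* + 3)) lo)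
  (subst (λ i → x <ʳ i /3) (sym (ℤ.suc-* m (+ 3))) hi))

-- Triples of thirds are moved from `c` into `m` until `c < 3`; then `m` is the floor of `x` and `c`
-- tells which third of the unit interval contains the fractional part.
f-φ : ∀ c m x → (+ c ℤ.+ m ℤ.* + 3) /3 ≤ʳ x → x <ʳ (+ suc c ℤ.+ m ℤ.* + 3) /3 → f x ≡ φ c /3
f-φ (suc (suc (suc c))) m x lo hi =
  f-φ c (ℤ.suc m) x (subst (λ k → k /3 ≤ʳ x) (shift (+ c) m) lo)
                    (subst (λ k → x <ʳ k /3) (shift (+ suc c) m) hi)
  where
  shift : ∀ c m → + 3 ℤ.+ c ℤ.+ m ℤ.* + 3 ≡ c ℤ.+ (+ 1 ℤ.+ m) ℤ.* + 3
  shift = ℤ-Solver.solve-∀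
f-φ 0 m x lo hi = trans (f-floor x m lo (<ʳ-≤-trans x hi (+/3-mono m (s≤s z≤n)))) (cong (ℚ._- + 1 /3)
  (𝟙-outside (x -ʳ fromℤ m) λ (⅓≤ , _) → ⅓≤ (subst (x <ʳ_) (sym (/3-+-fromℤ (+ 1) m)) hi)))
f-φ 1 m x lo hi = trans
  (f-floor x m (≤-≤ʳ-trans x (+/3-mono m z≤n) lo) (<ʳ-≤-trans x hi (+/3-mono m (s≤s (s≤s z≤n)))))
  (cong (ℚ._- + 1 /3) (𝟙-inside (x -ʳ fromℤ m)
    (subst (_≤ʳ x) (sym (/3-+-fromℤ (+ 1) m)) lo) (subst (x <ʳ_) (sym (/3-+-fromℤ (+ 2) m)) hi)))
f-φ 2 m x lo hi = trans (f-floor x m (≤-≤ʳ-trans x (+/3-mono m z≤n) lo) hi) (cong (ℚ._- + 1 /3)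
  (𝟙-outside (x -ʳ fromℤ m) λ (_ , <⅔) → lo (subst (x <ʳ_) (/3-+-fromℤ (+ 2) m) <⅔)))

-- Values of f_A on the cells of a grid.

-- With denominators cleared, the inequality assumed is i/(3a) ≤ k/M, and the two conditions on `x`
-- compare it with exactly these fractions. `·-upper` is the mirror image.
·-lower : ∀ a M .{{_ : NonZero a}} .{{_ : NonZero M}} x i k → i ℤ.* + M ℤ.≤ k ℤ.* + (3 * a) →
          fromℤ k ≤ʳ M · x → i /3 ≤ʳ a · x
·-lower (suc a) (suc M) x i k le = ≤-≤ʳ-trans x (≈-≤ (*1/-≈ a (/3-≈ i)) (*1/-≈ M (fromℤ-≈ k))
  (subst₂ ℤ._≤_ (cong₂ ℤ._*_ (sym (ℤ.*-identityʳ i)) (cong +_ (sym (ℕ.*-identityˡ (suc M)))))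
                (cong (ℤ._* + (3 * suc a)) (sym (ℤ.*-identityʳ k))) le))

·-upper : ∀ a M .{{_ : NonZero a}} .{{_ : NonZero M}} x i k → k ℤ.* + (3 * a) ℤ.≤ i ℤ.* + M →
          M · x <ʳ fromℤ k → a · x <ʳ i /3
·-upper (suc a) (suc M) x i k le x<k = <ʳ-≤-trans x x<k (≈-≤ (*1/-≈ M (fromℤ-≈ k)) (*1/-≈ a (/3-≈ i))
  (subst₂ ℤ._≤_ (cong (ℤ._* + (3 * suc a)) (sym (ℤ.*-identityʳ k)))
                (cong₂ ℤ._*_ (sym (ℤ.*-identityʳ i)) (cong +_ (sym (ℕ.*-identityˡ (suc M))))) le))

-- ⌊M x⌋ ≡ r (mod M); together with the divisibility of M by 3a, this determines f(ax).
record Cell (M : ℕ) (x : ℝ) (r : ℕ) : Set where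
  constructor mkCell
  field
    period : ℤ
    lower  : fromℤ (+ r ℤ.+ period ℤ.* + M) ≤ʳ M · x
    higher : M · x <ʳ fromℤ (+ suc r ℤ.+ period ℤ.* + M)

cell : ∀ M .{{_ : NonZero M}} x → ∃[ r ] (r < M × Cell M x r)
cell M x with floor (M · x)
... | k , k≤Mx , Mx<1+k =
  k ℤ.%ℕ M , ℤ.n%ℕd<d k M , mkCell (k ℤ./ℕ M)
  (subst (λ i → fromℤ i ≤ʳ M · x) (ℤ.a≡a%ℕn+[a/ℕn]*n k M) k≤Mx)
  (subst (λ i → M · x <ʳ fromℤ i)
    (trans (cong ℤ.suc (ℤ.a≡a%ℕn+[a/ℕn]*n k M))
           (sym (ℤ.+-assoc (+ 1) (+ (k ℤ.%ℕ M)) (k ℤ./ℕ M ℤ.* + M)))) Mx<1+k)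

-- Cells are closed on the left, so the end point r/M belongs to its cell, with period 0.
cell-inhabited : ∀ M .{{_ : NonZero M}} r → ∃[ x ] Cell M x r
cell-inhabited (suc M) r = fromℚ (+ r ℚ./ suc M) , mkCell (+ 0)
  (λ lt → ℤ.<-irrefl (eq (+ r) (+ suc M))
     (subst (λ n → + r ℤ.* + n ℤ.< (+ r ℤ.+ + 0) ℤ.* + 1 ℤ.* + suc M) (ℕ.*-identityˡ (suc M))
       (<-≈ r≈ (*1/-≈ M (fromℤ-≈ (+ r ℤ.+ + 0))) (toWitness lt))))
  (fromWitness (≈-< r≈ (*1/-≈ M (fromℤ-≈ (+ suc r ℤ.+ + 0)))
    (subst₂ ℤ._<_ (cong (λ n → + r ℤ.* + n) (sym (ℕ.*-identityˡ (suc M)))) (eq (+ suc r) (+ suc M))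
      (ℤ.*-monoʳ-<-pos (+ suc M) (ℤ.+<+ (ℕ.n<1+n r))))))
  where
  r≈ : + r ℚ./ suc M ≈ + r ÷ suc M
  r≈ = /-≈ (+ r) (suc M)
  eq : ∀ r n → r ℤ.* n ≡ (r ℤ.+ + 0) ℤ.* + 1 ℤ.* n
  eq = ℤ-Solver.solve-∀

-- Since L = ba, 3ax is 3Lx divided by the integer `b`, so its floor depends only on that of 3Lx. It
-- equals `a * r / L` plus 3ma, a multiple of 3 that does not affect f. Writing ar/L for r/b makes
-- the formula uniform in `a`.
f-cell : ∀ {a L} .{{_ : NonZero L}} → a ∣ L → ∀ {x r} → Cell (3 * L) x r → f (a · x) ≡ φ (a * r / L) /3
f-cell {a} {L} (divides b L≡ba) {x} {r} (mkCell m lo hi) =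
  f-φ c (m ℤ.* + a) (a · x)
    (·-lower a (3 * L) x (+ c ℤ.+ m ℤ.* + a ℤ.* + 3) (+ r ℤ.+ m ℤ.* + (3 * L))
      (subst₂ ℤ._≤_ (sym (cross₁ c)) (sym (cross₂ r)) (cross-mono c*L≤r*a)) lo)
    (·-upper a (3 * L) x (+ suc c ℤ.+ m ℤ.* + a ℤ.* + 3) (+ suc r ℤ.+ m ℤ.* + (3 * L))
      (subst₂ ℤ._≤_ (sym (cross₂ (suc r))) (sym (cross₁ (suc c)))
       (cross-mono 1+r*a≤1+c*L)) hi)
  where
  instance
    ba≢0 : NonZero (b * a)
    ba≢0 = subst NonZero L≡ba (>-nonZero (>-nonZero⁻¹ L))
    a≢0 : NonZero a
    a≢0 = ℕ.m*n≢0⇒n≢0 b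
    3L≢0 : NonZero (3 * L)
    3L≢0 = ℕ.m*n≢0 3 L

  c = a * r / L

  -- After cross-multiplication the period contributes the same term 9maL to both sides, so only
  -- `c * L` and `r * a` remain to be compared.
  cross₁ : ∀ c → (+ c ℤ.+ m ℤ.* + a ℤ.* + 3) ℤ.* + (3 * L)
               ≡ + 3 ℤ.* + (c * L) ℤ.+ + 9 ℤ.* (m ℤ.* + a ℤ.* + L)
  cross₁ c = trans (cong (ℤ._*_ (+ c ℤ.+ m ℤ.* + a ℤ.* + 3)) (ℤ.pos-* 3 L))
    (trans (eq (+ c) m (+ a) (+ L))
    (cong (λ k → + 3 ℤ.* k ℤ.+ + 9 ℤ.* (m ℤ.* + a ℤ.* + L)) (sym (ℤ.pos-* c L))))
    where
    eq : ∀ c m a L → (c ℤ.+ m ℤ.* a ℤ.* + 3) ℤ.* (+ 3 ℤ.* L)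
                   ≡ + 3 ℤ.* (c ℤ.* L) ℤ.+ + 9 ℤ.* (m ℤ.* a ℤ.* L)
    eq = ℤ-Solver.solve-∀

  cross₂ : ∀ r → (+ r ℤ.+ m ℤ.* + (3 * L)) ℤ.* + (3 * a)
               ≡ + 3 ℤ.* + (r * a) ℤ.+ + 9 ℤ.* (m ℤ.* + a ℤ.* + L)
  cross₂ r = trans (cong₂ (λ k l → (+ r ℤ.+ m ℤ.* k) ℤ.* l) (ℤ.pos-* 3 L) (ℤ.pos-* 3 a))
    (trans (eq (+ r) m (+ a) (+ L))
    (cong (λ k → + 3 ℤ.* k ℤ.+ + 9 ℤ.* (m ℤ.* + a ℤ.* + L)) (sym (ℤ.pos-* r a))))
    where
    eq : ∀ r m a L → (r ℤ.+ m ℤ.* (+ 3 ℤ.* L)) ℤ.* (+ 3 ℤ.* a)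
                   ≡ + 3 ℤ.* (r ℤ.* a) ℤ.+ + 9 ℤ.* (m ℤ.* a ℤ.* L)
    eq = ℤ-Solver.solve-∀

  cross-mono : ∀ {u v} → u ≤ v → + 3 ℤ.* + u ℤ.+ + 9 ℤ.* (m ℤ.* + a ℤ.* + L)
                           ℤ.≤ + 3 ℤ.* + v ℤ.+ + 9 ℤ.* (m ℤ.* + a ℤ.* + L)
  cross-mono u≤v = ℤ.+-monoˡ-≤ _ (ℤ.*-monoˡ-≤-nonNeg (+ 3) (ℤ.+≤+ u≤v))

  c*L≤r*a : c * L ≤ r * a
  c*L≤r*a = subst (c * L ≤_) (ℕ.*-comm a r) (ℕ.m/n*n≤m (a * r) L)

  -- a r < (1 + c) L = (1 + c) b a, and a can be cancelled since it divides L.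
  1+r*a≤1+c*L : suc r * a ≤ suc c * L
  1+r*a≤1+c*L = subst (suc r * a ≤_) assoc (ℕ.*-monoˡ-≤ a (ℕ.*-cancelʳ-< a r (suc c * b)
    (subst₂ _<_ (ℕ.*-comm a r) (sym assoc)
      (subst (_< L + c * L) (sym (ℕ.m≡m%n+[m/n]*n (a * r) L)) (ℕ.+-monoˡ-< (c * L) (ℕ.m%n<n (a * r) L))))))
    where
    assoc : suc c * b * a ≡ suc c * L
    assoc = trans (ℕ.*-assoc (suc c) b a) (cong (suc c *_) (sym L≡ba))

-- When every element divides `L`, this is 3 f_A on cell `r` of the grid of mesh 1/(3L).
∑φ : (L : ℕ) .{{_ : NonZero L}} → ℕ → List ℕ → ℤ
∑φ L r as = foldr ℤ._+_ (+ 0) (map (λ a → φ (a * r / L)) as)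

f[]-cell : ∀ L .{{_ : NonZero L}} A → All (_∣ L) (elements A) → ∀ {x r} → Cell (3 * L) x r →
           f[ A ] x ≡ ∑φ L r (elements A) /3
f[]-cell L A ∣L {x} {r} x∈ = go ∣L
  where
  go : ∀ {as} → All (_∣ L) as → foldr ℚ._+_ 0ℚ (map (λ a → f (a · x)) as) ≡ ∑φ L r as /3
  go []         = refl
  go {a ∷ as} (a∣L ∷ ∣L) = trans (cong₂ ℚ._+_ (f-cell a∣L x∈) (go ∣L)) (/3-+ (φ (a * r / L)) (∑φ L r as))

-- Existence of the maximum and its description on the grid.

maximum : ∀ (g : ℕ → ℤ) n → ∃[ s ] (∀ {r} → r < n → g r ℤ.≤ g s)
-- The witness 0 is a default: no `r` lies below 0.
maximum g zero    = 0 , λ ()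
maximum g (suc n) with maximum g n
... | s , g≤gs with ℤ.≤-total (g n) (g s)
... | inj₁ gn≤gs = s , λ { (s≤s r≤n) → [ g≤gs , (λ { refl → gn≤gs }) ]′ (ℕ.m≤n⇒m<n∨m≡n r≤n) }
... | inj₂ gs≤gn = n , λ { (s≤s r≤n) →
  [ (λ r<n → ℤ.≤-trans (g≤gs r<n) gs≤gn) , (λ { refl → ℤ.≤-refl }) ]′ (ℕ.m≤n⇒m<n∨m≡n r≤n) }

f[]-mono : ∀ L .{{_ : NonZero L}} A → All (_∣ L) (elements A) →
           ∀ {x y r s} → Cell (3 * L) x r → Cell (3 * L) y s →
           ∑φ L r (elements A) ℤ.≤ ∑φ L s (elements A) → f[ A ] x ℚ.≤ f[ A ] y
f[]-mono L A ∣L {x} {y} {r} {s} x∈ y∈ le =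
  subst (ℚ._≤ f[ A ] y) (sym (f[]-cell L A ∣L {x} {r} x∈))
    (subst (∑φ L r (elements A) /3 ℚ.≤_) (sym (f[]-cell L A ∣L {y} {s} y∈))
      (/3-mono-≤ {∑φ L r (elements A)} {∑φ L s (elements A)} le))

-- Every real lies in one of the `3 * L` cells and f_A is constant on each, so a point of a best
-- cell is a maximiser.
m≥-value : ∀ L .{{_ : NonZero L}} .{{_ : NonZero (3 * L)}} A → All (_∣ L) (elements A) →
           ∀ x c → c ℚ.≤ f[ A ] x → m[ A ]≥ c
m≥-value L A ∣L x c c≤fx with maximum (λ r → ∑φ L r (elements A)) (3 * L)
... | s , max with cell-inhabited (3 * L) s
... | y , y∈ = f[ A ] y , ((y , refl) , f≤fy) , ℚ.≤-trans c≤fx (f≤fy x)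
  where
  f≤fy : ∀ x → f[ A ] x ℚ.≤ f[ A ] y
  f≤fy x with cell (3 * L) x
  ... | r , r<3L , x∈ = f[]-mono L A ∣L x∈ y∈ (max r<3L)

-- Together with `grid-m≥`, this turns lower bounds on m_A into integer inequalities between grid
-- sums, so that real numbers can be left behind.
m≥-grid : ∀ L .{{_ : NonZero L}} .{{_ : NonZero (3 * L)}} A → All (_∣ L) (elements A) →
          ∀ r k → k ℤ.≤ ∑φ L r (elements A) → m[ A ]≥ (k /3)
m≥-grid L A ∣L r k k≤ with cell-inhabited (3 * L) r
... | x , x∈ = m≥-value L A ∣L x (k /3)
  (subst (k /3 ℚ.≤_) (sym (f[]-cell L A ∣L {x} {r} x∈)) (/3-mono-≤ {k} {∑φ L r (elements A)} k≤))

grid-m≥ : ∀ L .{{_ : NonZero L}} .{{_ : NonZero (3 * L)}} A → All (_∣ L) (elements A) →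
          ∀ k → m[ A ]≥ (k /3) → ∃[ r ] k ℤ.≤ ∑φ L r (elements A)
grid-m≥ L A ∣L k (m , ((x , fx≡m) , _) , k≤m) with cell (3 * L) x
... | r , _ , x∈ = r , /3-cancel-≤ {k} {∑φ L r (elements A)}
  (subst (k /3 ℚ.≤_) (trans (sym fx≡m) (f[]-cell L A ∣L {x} {r} x∈)) k≤m)


-- The set A′ of thirds of the multiples of 3 in A.

data Mod3 : ℕ → Set where
  0+ : ∀ d → Mod3 (d * 3)
  1+ : ∀ d → Mod3 (1 + d * 3)
  2+ : ∀ d → Mod3 (2 + d * 3)

mod3 : ∀ a → Mod3 a
mod3 zero    = 0+ 0
mod3 (suc a) with mod3 a
... | 0+ d = 1+ d
... | 1+ d = 2+ d
... | 2+ d = 0+ (suc d)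

infixr 5 _∷⅓_

-- The residue is an argument, so that a lemma about one step of `thirds` can match on it directly.
_∷⅓_ : ∀ {a} → Mod3 a → List ℕ → List ℕ
0+ d ∷⅓ ds = d ∷ ds
1+ _ ∷⅓ ds = ds
2+ _ ∷⅓ ds = ds

thirds : List ℕ → List ℕ
thirds []       = []
thirds (a ∷ as) = mod3 a ∷⅓ thirds as

thirds⁺ : ∀ {P : ℕ → Set} {as} → All P as → All (λ d → P (d * 3)) (thirds as)
thirds⁺ []                  = []
thirds⁺ {as = a ∷ _} (p ∷ ps) with mod3 a
... | 0+ _ = p ∷ thirds⁺ ps
... | 1+ _ = thirds⁺ ps
... | 2+ _ = thirds⁺ ps

thirds-unique : ∀ {as} → Unique as → Unique (thirds as)
thirds-unique []                          = []
thirds-unique {a ∷ _} (a∉as ∷ as-unique) with mod3 a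
... | 0+ _ = All.map (λ d*3≢ → d*3≢ ∘ cong (_* 3)) (thirds⁺ a∉as) ∷ thirds-unique as-unique
... | 1+ _ = thirds-unique as-unique
... | 2+ _ = thirds-unique as-unique

-- Makes the sum of the elements a measure for the descent from A to A′.
sum-thirds : ∀ as → sum (thirds as) * 3 ≤ sum as
sum-thirds []       = z≤n
sum-thirds (a ∷ as) with mod3 a
... | 0+ d = subst (_≤ d * 3 + sum as) (sym (ℕ.*-distribʳ-+ 3 d (sum (thirds as))))
                   (ℕ.+-monoʳ-≤ (d * 3) (sum-thirds as))
... | 1+ d = ℕ.m≤n⇒m≤o+n (1 + d * 3) (sum-thirds as)
... | 2+ d = ℕ.m≤n⇒m≤o+n (2 + d * 3) (sum-thirds as)

third : FiniteSet⁺ → FiniteSet⁺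
third A = record
  { elements = thirds (elements A)
  ; positive = All.map (λ {d} → ℕ.*-cancelʳ-< 3 0 d) (thirds⁺ (positive A))
  ; distinct = thirds-unique (distinct A)
  }

-- Averaging over translates by 1/3.

φ-periodic : ∀ c d → φ (c + d * 3) ≡ φ c
φ-periodic c zero    = cong φ (ℕ.+-identityʳ c)
φ-periodic c (suc d) = trans (cong φ (eq c d)) (φ-periodic c d)
  where
  eq : ∀ c d → c + (3 + d * 3) ≡ 3 + (c + d * 3)
  eq = ℕ-Solver.solve-∀

φ-sum : ∀ c → φ c ℤ.+ φ (1 + c) ℤ.+ φ (2 + c) ≡ + 0
φ-sum 0                   = refl
φ-sum 1                   = refl
φ-sum 2                   = refl
φ-sum (suc (suc (suc c))) = φ-sum c

-- Modulo 3 the arguments are c, c + 1, c + 2; in `φ-sum-2+` the last two trade places. The factors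
-- 1 and 2 match the `a * t` of `shift-/`.
φ-sum-1+ : ∀ c d → φ c ℤ.+ φ (c + (1 + d * 3) * 1) ℤ.+ φ (c + (1 + d * 3) * 2) ≡ + 0
φ-sum-1+ c d = trans (cong₂ (λ u v → φ c ℤ.+ u ℤ.+ v)
  (trans (cong φ (eq₁ c d)) (φ-periodic (1 + c) d))
  (trans (cong φ (eq₂ c d)) (φ-periodic (2 + c) (d * 2)))) (φ-sum c)
  where
  eq₁ : ∀ c d → c + (1 + d * 3) * 1 ≡ 1 + c + d * 3
  eq₁ = ℕ-Solver.solve-∀
  eq₂ : ∀ c d → c + (1 + d * 3) * 2 ≡ 2 + c + d * 2 * 3
  eq₂ = ℕ-Solver.solve-∀

φ-sum-2+ : ∀ c d → φ c ℤ.+ φ (c + (2 + d * 3) * 1) ℤ.+ φ (c + (2 + d * 3) * 2) ≡ + 0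
φ-sum-2+ c d = trans (cong₂ (λ u v → φ c ℤ.+ u ℤ.+ v)
  (trans (cong φ (eq₁ c d)) (φ-periodic (2 + c) d))
  (trans (cong φ (eq₂ c d)) (φ-periodic (1 + c) (1 + d * 2))))
  (trans (swap (φ c) (φ (2 + c)) (φ (1 + c))) (φ-sum c))
  where
  eq₁ : ∀ c d → c + (2 + d * 3) * 1 ≡ 2 + c + d * 3
  eq₁ = ℕ-Solver.solve-∀
  eq₂ : ∀ c d → c + (2 + d * 3) * 2 ≡ 1 + c + (1 + d * 2) * 3
  eq₂ = ℕ-Solver.solve-∀
  swap : ∀ u v w → u ℤ.+ v ℤ.+ w ≡ u ℤ.+ w ℤ.+ v
  swap = ℤ-Solver.solve-∀

rearrange : ∀ u u′ v v′ w w′ →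
  (u ℤ.+ u′) ℤ.+ (v ℤ.+ v′) ℤ.+ (w ℤ.+ w′) ≡ (u ℤ.+ v ℤ.+ w) ℤ.+ (u′ ℤ.+ v′ ℤ.+ w′)
rearrange = ℤ-Solver.solve-∀

-- On the grid of the points r/(3M), translation by 1/3 is r ↦ r + M.
shift-/ : ∀ a r t M .{{_ : NonZero M}} → a * (r + t * M) / M ≡ a * r / M + a * t
shift-/ a r t M = begin
  a * (r + t * M) / M        ≡⟨ cong (_/ M) (ℕ.*-distribˡ-+ a r (t * M)) ⟩
  (a * r + a * (t * M)) / M  ≡⟨ cong (λ k → (a * r + k) / M) (sym (ℕ.*-assoc a t M)) ⟩
  (a * r + a * t * M) / M    ≡⟨ ℕ.+-distrib-/-∣ʳ (a * r) (divides (a * t) refl) ⟩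
  a * r / M + a * t * M / M  ≡⟨ cong (_+_ (a * r / M)) (ℕ.m*n/n≡m (a * t) M) ⟩
  a * r / M + a * t          ∎
  where open ≡-Reasoning

-- Translating by t/3 changes 3dx by the integer dt, which the period of f absorbs; then the factor
-- 3 cancels in the quotient.
φ-0+ : ∀ L .{{_ : NonZero L}} .{{_ : NonZero (3 * L)}} r d t →
  φ (d * 3 * (r + t * (3 * L)) / (3 * L)) ≡ φ (d * r / L)
φ-0+ L r d t = begin
  φ (d * 3 * (r + t * (3 * L)) / (3 * L))    ≡⟨ cong φ (shift-/ (d * 3) r t (3 * L)) ⟩
  φ (d * 3 * r / (3 * L) + d * 3 * t)        ≡⟨ cong (λ k → φ (d * 3 * r / (3 * L) + k)) (eq₁ d t) ⟩
  φ (d * 3 * r / (3 * L) + d * t * 3)        ≡⟨ φ-periodic (d * 3 * r / (3 * L)) (d * t) ⟩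
  φ (d * 3 * r / (3 * L))                    ≡⟨ cong (λ k → φ (k / (3 * L))) (eq₂ d r) ⟩
  φ (3 * (d * r) / (3 * L))                  ≡⟨ cong φ (ℕ.m*n/m*o≡n/o 3 (d * r) L) ⟩
  φ (d * r / L)                              ∎
  where
  open ≡-Reasoning
  eq₁ : ∀ d t → d * 3 * t ≡ d * t * 3
  eq₁ = ℕ-Solver.solve-∀
  eq₂ : ∀ d r → d * 3 * r ≡ 3 * (d * r)
  eq₂ = ℕ-Solver.solve-∀

-- The three values of an element not divisible by 3 cancel, so only the rest of the list counts;
-- `h t` stands for the sum over that rest at translate `t`.
φ-cancel : ∀ L .{{_ : NonZero L}} .{{_ : NonZero (3 * L)}} r a ds (h : ℕ → ℤ) →
  h 0 ℤ.+ h 1 ℤ.+ h 2 ≡ + 3 ℤ.* ∑φ L r ds →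
  let c = a * r / (3 * L)
      g = λ t → φ (a * (r + t * (3 * L)) / (3 * L)) ℤ.+ h t in
  φ c ℤ.+ φ (c + a * 1) ℤ.+ φ (c + a * 2) ≡ + 0 → g 0 ℤ.+ g 1 ℤ.+ g 2 ≡ + 3 ℤ.* ∑φ L r ds
φ-cancel L r a ds h h-average φ≡0 = begin
  (φ′ 0 ℤ.+ h 0) ℤ.+ (φ′ 1 ℤ.+ h 1) ℤ.+ (φ′ 2 ℤ.+ h 2)  ≡⟨ rearrange (φ′ 0) (h 0) (φ′ 1) (h 1) (φ′ 2) (h 2) ⟩
  (φ′ 0 ℤ.+ φ′ 1 ℤ.+ φ′ 2) ℤ.+ (h 0 ℤ.+ h 1 ℤ.+ h 2)    ≡⟨ cong₂ ℤ._+_ φ′≡0 h-average ⟩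
  + 0 ℤ.+ + 3 ℤ.* ∑φ L r ds                             ≡⟨ ℤ.+-identityˡ (+ 3 ℤ.* ∑φ L r ds) ⟩
  + 3 ℤ.* ∑φ L r ds                                     ∎
  where
  open ≡-Reasoning
  φ′ : ℕ → ℤ
  φ′ t = φ (a * (r + t * (3 * L)) / (3 * L))
  φ′≡0 : φ′ 0 ℤ.+ φ′ 1 ℤ.+ φ′ 2 ≡ + 0
  φ′≡0 = trans (cong₂ ℤ._+_ (cong₂ ℤ._+_
    (cong (λ k → φ (a * k / (3 * L))) (ℕ.+-identityʳ r))
    (cong φ (shift-/ a r 1 (3 * L)))) (cong φ (shift-/ a r 2 (3 * L)))) φ≡0

φ-average : ∀ L .{{_ : NonZero L}} .{{_ : NonZero (3 * L)}} r {a} (μ : Mod3 a) ds (h : ℕ → ℤ) →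
  h 0 ℤ.+ h 1 ℤ.+ h 2 ≡ + 3 ℤ.* ∑φ L r ds →
  let g = λ t → φ (a * (r + t * (3 * L)) / (3 * L)) ℤ.+ h t in
  g 0 ℤ.+ g 1 ℤ.+ g 2 ≡ + 3 ℤ.* ∑φ L r (μ ∷⅓ ds)
φ-average L r (0+ d) ds h h-average = begin
  (φ′ 0 ℤ.+ h 0) ℤ.+ (φ′ 1 ℤ.+ h 1) ℤ.+ (φ′ 2 ℤ.+ h 2)  ≡⟨ rearrange (φ′ 0) (h 0) (φ′ 1) (h 1) (φ′ 2) (h 2) ⟩
  (φ′ 0 ℤ.+ φ′ 1 ℤ.+ φ′ 2) ℤ.+ (h 0 ℤ.+ h 1 ℤ.+ h 2)    ≡⟨ cong₂ ℤ._+_ (cong₂ ℤ._+_ (cong₂ ℤ._+_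
    (φ-0+ L r d 0) (φ-0+ L r d 1)) (φ-0+ L r d 2)) h-average ⟩
  (v ℤ.+ v ℤ.+ v) ℤ.+ + 3 ℤ.* ∑φ L r ds                 ≡⟨ collect v (∑φ L r ds) ⟩
  + 3 ℤ.* (v ℤ.+ ∑φ L r ds)                             ∎
  where
  open ≡-Reasoning
  φ′ : ℕ → ℤ
  φ′ t = φ (d * 3 * (r + t * (3 * L)) / (3 * L))
  v = φ (d * r / L)
  collect : ∀ v w → (v ℤ.+ v ℤ.+ v) ℤ.+ + 3 ℤ.* w ≡ + 3 ℤ.* (v ℤ.+ w)
  collect = ℤ-Solver.solve-∀
φ-average L r (1+ d) ds h h-average =
  φ-cancel L r (1 + d * 3) ds h h-average (φ-sum-1+ ((1 + d * 3) * r / (3 * L)) d)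
φ-average L r (2+ d) ds h h-average =
  φ-cancel L r (2 + d * 3) ds h h-average (φ-sum-2+ ((2 + d * 3) * r / (3 * L)) d)

-- The same `r` serves two grids: it stands for x = r/(3L) on the right and for x/3 = r/(9L) on the
-- left, where adding `3 * L` translates by 1/3.
∑φ-average : ∀ L .{{_ : NonZero L}} .{{_ : NonZero (3 * L)}} r as →
  let g = λ t → ∑φ (3 * L) (r + t * (3 * L)) as in g 0 ℤ.+ g 1 ℤ.+ g 2 ≡ + 3 ℤ.* ∑φ L r (thirds as)
∑φ-average L r []       = refl
∑φ-average L r (a ∷ as) = φ-average L r (mod3 a) (thirds as)
  (λ t → ∑φ (3 * L) (r + t * (3 * L)) as) (∑φ-average L r as)

-- Counting at the points 1/3 and 2/3.

φ-count-nonmultiple : ∀ u v n → -[1+ 0 ] ℤ.+ u ℤ.+ v ≡ + 0 → u ℤ.+ v ℤ.+ + 3 ℤ.* + n ≡ + 1 ℤ.+ + 3 ℤ.* + n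
φ-count-nonmultiple u v n eq = cong (ℤ._+ + 3 ℤ.* + n) (trans (shift u v) (cong (ℤ._+_ (+ 1)) eq))
  where
  shift : ∀ u v → u ℤ.+ v ≡ + 1 ℤ.+ (-[1+ 0 ] ℤ.+ u ℤ.+ v)
  shift = ℤ-Solver.solve-∀

-- A multiple of 3 contributes -1 at both points but lengthens the list of thirds by one, and -2 + 3
-- = 1. For any other element the values at 0, 1/3 and 2/3 cancel; the one at 0 is -1, so the other
-- two add up to 1.
φ-count : ∀ {a} (μ : Mod3 a) ds →
  φ (a * 1) ℤ.+ φ (a * 2) ℤ.+ + 3 ℤ.* + length (μ ∷⅓ ds) ≡ + 1 ℤ.+ + 3 ℤ.* + length ds
φ-count (0+ d) ds = trans
  (cong₂ (λ u v → u ℤ.+ v ℤ.+ + 3 ℤ.* + suc (length ds)) (multiple 1) (multiple 2)) (eq (+ length ds))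
  where
  multiple : ∀ t → φ (d * 3 * t) ≡ φ 0
  multiple t = trans (cong φ (swap d t)) (φ-periodic 0 (d * t))
    where
    swap : ∀ d t → d * 3 * t ≡ d * t * 3
    swap = ℕ-Solver.solve-∀
  eq : ∀ n → -[1+ 0 ] ℤ.+ -[1+ 0 ] ℤ.+ + 3 ℤ.* (+ 1 ℤ.+ n) ≡ + 1 ℤ.+ + 3 ℤ.* n
  eq = ℤ-Solver.solve-∀
φ-count {a} (1+ d) ds = φ-count-nonmultiple (φ (a * 1)) (φ (a * 2)) (length ds) (φ-sum-1+ 0 d)
φ-count {a} (2+ d) ds = φ-count-nonmultiple (φ (a * 1)) (φ (a * 2)) (length ds) (φ-sum-2+ 0 d)

-- On the grid of mesh 1/(3L), the indices `1 * L` and `2 * L` are the points 1/3 and 2/3. By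
-- `φ-count` each element adds exactly 1 to the left side.
∑φ-count : ∀ L .{{_ : NonZero L}} as →
  ∑φ L (1 * L) as ℤ.+ ∑φ L (2 * L) as ℤ.+ + 3 ℤ.* + length (thirds as) ≡ + length as
∑φ-count L []       = refl
∑φ-count L (a ∷ as) = begin
  (φ₁ ℤ.+ s₁) ℤ.+ (φ₂ ℤ.+ s₂) ℤ.+ + 3 ℤ.* + length (mod3 a ∷⅓ thirds as)
    ≡⟨ cong₂ (λ u v → (u ℤ.+ s₁) ℤ.+ (v ℤ.+ s₂) ℤ.+ n′) (cong φ (cancel 1)) (cong φ (cancel 2)) ⟩
  (φ (a * 1) ℤ.+ s₁) ℤ.+ (φ (a * 2) ℤ.+ s₂) ℤ.+ n′
    ≡⟨ regroup (φ (a * 1)) s₁ (φ (a * 2)) s₂ n′ ⟩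
  (φ (a * 1) ℤ.+ φ (a * 2) ℤ.+ n′) ℤ.+ (s₁ ℤ.+ s₂)
    ≡⟨ cong (ℤ._+ (s₁ ℤ.+ s₂)) (φ-count (mod3 a) (thirds as)) ⟩
  (+ 1 ℤ.+ n) ℤ.+ (s₁ ℤ.+ s₂)
    ≡⟨ regroup′ n s₁ s₂ ⟩
  + 1 ℤ.+ (s₁ ℤ.+ s₂ ℤ.+ n)
    ≡⟨ cong (ℤ._+_ (+ 1)) (∑φ-count L as) ⟩
  + suc (length as) ∎
  where
  open ≡-Reasoning
  φ₁ = φ (a * (1 * L) / L)
  φ₂ = φ (a * (2 * L) / L)
  s₁ = ∑φ L (1 * L) as
  s₂ = ∑φ L (2 * L) as
  n  = + 3 ℤ.* + length (thirds as)
  n′ = + 3 ℤ.* + length (mod3 a ∷⅓ thirds as)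
  cancel : ∀ t → a * (t * L) / L ≡ a * t
  cancel t = trans (cong (_/ L) (sym (ℕ.*-assoc a t L))) (ℕ.m*n/n≡m (a * t) L)
  regroup : ∀ u s v t n → (u ℤ.+ s) ℤ.+ (v ℤ.+ t) ℤ.+ n ≡ (u ℤ.+ v ℤ.+ n) ℤ.+ (s ℤ.+ t)
  regroup = ℤ-Solver.solve-∀
  regroup′ : ∀ n s t → (+ 1 ℤ.+ n) ℤ.+ (s ℤ.+ t) ≡ + 1 ℤ.+ (s ℤ.+ t ℤ.+ n)
  regroup′ = ℤ-Solver.solve-∀

-- Pigeonhole and descent on the sum of the elements.

pigeonhole₂ : ∀ k u v w → k ℤ.+ k ℤ.+ w ℤ.≤ u ℤ.+ v ℤ.+ w → k ℤ.≤ u ⊎ k ℤ.≤ v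
pigeonhole₂ k u v w le with k ℤ.≤? u
... | yes k≤u = inj₁ k≤u
... | no  k≰u = inj₂ (ℤ.≮⇒≥ λ v<k → ℤ.<⇒≱ (ℤ.+-monoˡ-< w (ℤ.+-mono-< (ℤ.≰⇒> k≰u) v<k)) le)

pigeonhole₃ : ∀ k (h : ℕ → ℤ) → + 3 ℤ.* k ℤ.≤ h 0 ℤ.+ h 1 ℤ.+ h 2 → ∃[ t ] k ℤ.≤ h t
pigeonhole₃ k h le with k ℤ.≤? h 0 | k ℤ.≤? h 1
... | yes k≤h | _       = 0 , k≤h
... | no  _   | yes k≤h = 1 , k≤h
... | no  k≰h₀ | no k≰h₁ = 2 , ℤ.≮⇒≥ λ h₂<k →
  ℤ.<⇒≱ (ℤ.+-mono-< (ℤ.+-mono-< (ℤ.≰⇒> k≰h₀) (ℤ.≰⇒> k≰h₁)) h₂<k)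
        (subst (ℤ._≤ h 0 ℤ.+ h 1 ℤ.+ h 2) (eq k) le)
  where
  eq : ∀ k → + 3 ℤ.* k ≡ k ℤ.+ k ℤ.+ k
  eq = ℤ-Solver.solve-∀

-- The product of the elements serves as the common multiple `L`.
∣-period : ∀ as → All (_∣ product as) as
∣-period as = All.tabulate ∈⇒∣product

period≢0 : ∀ A → NonZero (product (elements A))
period≢0 A = product≢0 (All.map >-nonZero (positive A))

m-third : ∀ A k → m[ third A ]≥ (k /3) → m[ A ]≥ (k /3)
m-third A k m≥ =
  -- `L` is the product over A and serves for A′ too: if d is in A′, then 3d divides `L`, hence so
  -- does d.
  let r , k≤ = grid-m≥ L (third A) (All.map (∣-trans (m∣m*n 3)) (thirds⁺ (∣-period as))) k m≥
      t , k≤ₜ = pigeonhole₃ k (λ t → ∑φ (3 * L) (r + t * (3 * L)) as)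
                 (subst (+ 3 ℤ.* k ℤ.≤_) (sym (∑φ-average L r as)) (ℤ.*-monoˡ-≤-nonNeg (+ 3) k≤))
  -- The point found is a translate of x/3, so A is evaluated on the grid three times as fine.
  in  m≥-grid (3 * L) A (All.map (∣n⇒∣m*n 3) (∣-period as)) (r + t * (3 * L)) k k≤ₜ
  where
  as = elements A
  L  = product as
  instance
    L≢0 : NonZero L
    L≢0 = period≢0 A
    3L≢0 : NonZero (3 * L)
    3L≢0 = ℕ.m*n≢0 3 L
    9L≢0 : NonZero (3 * (3 * L))
    9L≢0 = ℕ.m*n≢0 3 (3 * L)

-- By `∑φ-count`, 3 f_A(1/3) + 3 f_A(2/3) is the size of A minus three times that of A′, hence at
-- least 2S; one summand is then at least S.
m-few-thirds : ∀ A S → 3 * ∣ third A ∣ + 2 * S ≤ ∣ A ∣ → m[ A ]≥ (+ S /3)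
m-few-thirds A S le =
  [ m≥-grid L A (∣-period as) (1 * L) (+ S) , m≥-grid L A (∣-period as) (2 * L) (+ S) ]′
    (pigeonhole₂ (+ S) s₁ s₂ (+ 3 ℤ.* + n) (subst₂ ℤ._≤_ eq (sym (∑φ-count L as)) (ℤ.+≤+ le)))
  where
  as = elements A
  L  = product as
  n  = ∣ third A ∣
  instance
    L≢0 : NonZero L
    L≢0 = period≢0 A
    3L≢0 : NonZero (3 * L)
    3L≢0 = ℕ.m*n≢0 3 L
  s₁ = ∑φ L (1 * L) as
  s₂ = ∑φ L (2 * L) as
  eq : + (3 * n + 2 * S) ≡ (+ S ℤ.+ + S) ℤ.+ + 3 ℤ.* + n
  eq = trans (cong +_ (swap n S)) (cong (λ k → + S ℤ.+ + S ℤ.+ k) (ℤ.pos-* 3 n))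
    where
    swap : ∀ n S → 3 * n + 2 * S ≡ S + S + 3 * n
    swap = ℕ-Solver.solve-∀

-- Passing to A′ divides the sum by at least 3. Positivity of the sum over A gives strictness when
-- the sum over A′ is 0.
sum-third : ∀ A → 0 < ∣ A ∣ → sum (elements (third A)) < sum (elements A)
sum-third A ∣A∣>0 = descend _ (sum-thirds (elements A)) (sum-positive (positive A) ∣A∣>0)
  where
  sum-positive : ∀ {as} → All (0 <_) as → 0 < length as → 0 < sum as
  sum-positive {a ∷ as} (a>0 ∷ _) _ = ℕ.<-≤-trans a>0 (ℕ.m≤m+n a (sum as))
  descend : ∀ s {t} → s * 3 ≤ t → 0 < t → s < t
  descend zero    _  0<t = 0<t
  descend (suc s) le _   = ℕ.<-≤-trans (ℕ.m<m*n (suc s) 3 (s≤s (s≤s z≤n))) le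

theorem2 : (S : ℕ) .{{_ : NonZero S}} (N : ℕ) →
    (∀ n → N < n → n ≤ 3 * N + 2 * S →
    ∀ (A : FiniteSet⁺) → ∣ A ∣ ≡ n → m[ A ]≥ (+ S ℚ./ 3)) →
    ∀ n → N < n → ∀ (A : FiniteSet⁺) → ∣ A ∣ ≡ n → m[ A ]≥ (+ S ℚ./ 3)
theorem2 S N small n N<n A refl = go A (<-wellFounded (sum (elements A))) N<n
  where
  -- The recursion runs on the sum because A′ is as large as A when all elements are multiples of 3.
  go : ∀ A → Acc _<_ (sum (elements A)) → N < ∣ A ∣ → m[ A ]≥ (+ S /3)
  go A (acc rs) N<∣A∣ with ∣ A ∣ ℕ.≤? 3 * N + 2 * S | N ℕ.<? ∣ third A ∣
  ... | yes ∣A∣≤ | _          = small ∣ A ∣ N<∣A∣ ∣A∣≤ A refl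
  ... | no  _   | yes N<∣A/3∣ = m-third A (+ S)
    (go (third A) (rs (sum-third A (ℕ.≤-<-trans z≤n N<∣A∣))) N<∣A/3∣)
  -- Here A′ has at most `N` elements, so `3 * ∣ third A ∣ + 2 * S` is at most `3 * N + 2 * S`,
  -- which is below the size of A.
  ... | no  ∣A∣≰ | no  N≮∣A/3∣ = m-few-thirds A S
    (ℕ.≤-trans (ℕ.+-monoˡ-≤ (2 * S) (ℕ.*-monoʳ-≤ 3 (ℕ.≮⇒≥ N≮∣A/3∣))) (ℕ.<⇒≤ (ℕ.≰⇒> ∣A∣≰)))
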